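{- For every $m\in\mathbb{N}$ and every sufficiently large $n\in\mathbb{N}$ it holds that $$\mathsf{CC}(U_m\diamond\mathit{mKW}_{\textsc{Gen}_n})\ge m+\Omega(n^{1/6}).$$
   Context: "Sufficiently large $n$" means larger than a threshold that may depend on $m$; $A\ge B+\Omega(E)$ means $A\ge B+\kappa E$ for some absolute constant $\kappa>0$ (for all sufficiently large $n$). Given $\mathcal{T}\subseteq[n]^3$, $\mathcal{T}$ generates a point $w\in[n]$ if $w=1$, or if there is a triplet $(u,v,w)\in\mathcal{T}$ such that $\mathcal{T}$ generates $u$ and $v$ (inductive definition, i.e., the smallest such set of points). The function $g=\textsc{Gen}_n$ takes as input a set $\mathcal{T}\subseteq[n]^3$ (encoded by its characteristic vector in $\{0,1\}^{N}$, $N=n^3$) and outputs 1 iff $\mathcal{T}$ generates $n$. $U_m\diamond\mathit{mKW}_g$ is the following communication problem: Alice and Bob get matrices $X,Y\in\{0,1\}^{m\times N}$. Let $a,b\in\{0,1\}^m$ be obtained by applying $g$ to each row of $X$ and $Y$ respectively. It is promised that $a\ne b$ (a protocol only needs to be correct on such input pairs). The goal is to find $(i,j)$ such that ($a_i>b_i$ and $X_{i,j}>Y_{i,j}$), or ($a_i<b_i$ and $X_{i,j}<Y_{i,j}$), or ($a_i=b_i$ and $X_{i,j}\ne Y_{i,j}$). $\mathsf{CC}$ of a problem is the minimal depth of a deterministic protocol tree solving it. -}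

module Defs where

open import Data.Bool.Base using (Bool; true; false; if_then_else_) renaming (_<_ to _<ᵇ_)
import Data.Bool.Properties as Bool
open import Data.Fin.Base using (Fin; zero; toℕ; combine)
open import Data.Fin.Properties using (any?)
open import Data.Fin.Subset using (Subset; _∈_; _∉_; _⊃_; _∪_; ⁅_⁆; ⊥)
open import Data.Fin.Subset.Induction using (Acc; acc; ⊃-wellFounded)
open import Data.Fin.Subset.Properties using (_∈?_; ∉⊥; x∈⁅x⁆; x∈⁅y⁆⇒x≡y; p⊆p∪q; q⊆p∪q; x∈p∪q⁻)
open import Data.Nat.Base using (ℕ; zero; suc; _*_; _∸_; _^_; _≤_; _⊔_)
import Data.Nat.Properties as ℕ
open import Data.Empty using (⊥-elim)
open import Data.Product.Base using (∃-syntax; _×_; _,_)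
open import Data.Sum.Base using (_⊎_; inj₁; inj₂)
open import Data.Vec.Base using (Vec; lookup; map)
open import Relation.Binary.PropositionalEquality using (_≡_; _≢_; refl)
open import Relation.Nullary.Decidable using (Dec; yes; no; does; _×-dec_; _⊎-dec_; ¬?; decidable-stable)
open import Relation.Nullary.Negation using (¬_)

-- `Fin n` stands for [n] = {1, …, n}.
point : ∀ {n} → Fin n → ℕ
point i = suc (toℕ i)

-- The characteristic vector of a subset of [n]³.
Triplets : ℕ → Set
Triplets n = Vec Bool (n ^ 3)

tripletIndex : ∀ {n} → Fin n → Fin n → Fin n → Fin (n ^ 3)
tripletIndex u v w = combine u (combine v (combine w zero))

Contains : ∀ {n} → Triplets n → Fin n → Fin n → Fin n → Set
Contains T u v w = lookup T (tripletIndex u v w) ≡ true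

data Generates {n : ℕ} (T : Triplets n) : Fin n → Set where
  one     : ∀ {w} → point w ≡ 1 → Generates T w
  triplet : ∀ {u v w} → Contains T u v w → Generates T u → Generates T v → Generates T w

GeneratesLast : ∀ n → Triplets n → Set
GeneratesLast n T = ∃[ w ] (point w ≡ n × Generates {n} T w)

-- Decidability of generation, by saturating a set of generated points.
module _ {n : ℕ} (T : Triplets n) where

  private
    Step : Subset n → Fin n → Set
    Step S w = point w ≡ 1 ⊎ (∃[ u ] ∃[ v ] (Contains T u v w × u ∈ S × v ∈ S))

    New : Subset n → Set
    New S = ∃[ w ] (w ∉ S × Step S w)

    new? : ∀ S → Dec (New S)
    new? S = any? λ w → ¬? (w ∈? S) ×-dec ((point w ℕ.≟ 1) ⊎-dec
      any? λ u → any? λ v →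
        (lookup T (tripletIndex u v w) Bool.≟ true) ×-dec ((u ∈? S) ×-dec (v ∈? S)))

    Sound : Subset n → Set
    Sound S = ∀ {w} → w ∈ S → Generates T w

    step-sound : ∀ {S w} → Sound S → Step S w → Generates T w
    step-sound snd (inj₁ p)                     = one p
    step-sound snd (inj₂ (_ , _ , t , u∈S , v∈S)) = triplet t (snd u∈S) (snd v∈S)

    extend-sound : ∀ {S w} → Sound S → Step S w → Sound (S ∪ ⁅ w ⁆)
    extend-sound {S} {w} snd st x∈ with x∈p∪q⁻ S ⁅ w ⁆ x∈
    ... | inj₁ x∈S = snd x∈S
    ... | inj₂ x∈w with x∈⁅y⁆⇒x≡y w x∈w
    ...   | refl = step-sound snd st

    complete : ∀ {S} → ¬ New S → ∀ {w} → Generates T w → w ∈ S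
    complete {S} ¬new {w} g =
      decidable-stable (w ∈? S) λ w∉S → ¬new (w , w∉S , toStep g)
      where
      toStep : ∀ {w} → Generates T w → Step S w
      toStep (one p)         = inj₁ p
      toStep (triplet t a b) = inj₂ (_ , _ , t , complete ¬new a , complete ¬new b)

    search : ∀ S → Acc _⊃_ S → Sound S → ∀ w → Dec (Generates T w)
    search S (acc rec) snd w with new? S
    ... | yes (x , x∉S , st) =
      search (S ∪ ⁅ x ⁆)
        (rec (p⊆p∪q ⁅ x ⁆ , x , q⊆p∪q S ⁅ x ⁆ (x∈⁅x⁆ x) , x∉S))
        (extend-sound snd st) w
    ... | no ¬new with w ∈? S
    ...   | yes w∈S = yes (snd w∈S)
    ...   | no  w∉S = no λ g → w∉S (complete ¬new g)

  generates? : ∀ w → Dec (Generates T w)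
  generates? = search ⊥ (⊃-wellFounded ⊥) (λ w∈⊥ → ⊥-elim (∉⊥ w∈⊥))

  generatesLast? : Dec (GeneratesLast n T)
  generatesLast? = any? λ w → (point w ℕ.≟ n) ×-dec generates? w

Gen : ∀ n → Triplets n → Bool
Gen n T = does (generatesLast? {n} T)

record CommunicationProblem : Set₁ where
  field
    AliceInput BobInput Output : Set
    Promise : AliceInput → BobInput → Set
    Valid   : AliceInput → BobInput → Output → Set

open CommunicationProblem public

-- Deterministic protocol trees over Alice inputs A, Bob inputs B and outputs O.
-- At an internal node its owner sends one bit; on `true` the left child is taken.
data Protocol (A B O : Set) : Set where
  output : O → Protocol A B O
  alice  : (A → Bool) → (left right : Protocol A B O) → Protocol A B O
  bob    : (B → Bool) → (left right : Protocol A B O) → Protocol A B O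

depth : ∀ {A B O} → Protocol A B O → ℕ
depth (output _)    = 0
depth (alice _ l r) = suc (depth l ⊔ depth r)
depth (bob   _ l r) = suc (depth l ⊔ depth r)

run : ∀ {A B O} → Protocol A B O → A → B → O
run (output o)    x y = o
run (alice f l r) x y = if f x then run l x y else run r x y
run (bob   f l r) x y = if f y then run l x y else run r x y

ProtocolFor : CommunicationProblem → Set
ProtocolFor P = Protocol (AliceInput P) (BobInput P) (Output P)

Solves : (P : CommunicationProblem) → ProtocolFor P → Set
Solves P π = ∀ x y → Promise P x y → Valid P x y (run π x y)

-- "CC(P) = d".  A problem that no protocol solves has no such d (CC(P) = ∞).
record HasCC (P : CommunicationProblem) (d : ℕ) : Set where
  field
    attained : ∃[ π ] (Solves P π × depth π ≡ d)
    minimal  : ∀ π → Solves P π → d ≤ depth π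

-- `Vec Bool N` rather than `Fin N → Bool`, so that `_≡_` on inputs is extensional.
Matrix : ℕ → ℕ → Set
Matrix m N = Vec (Vec Bool N) m

module _ {m N : ℕ} (g : Vec Bool N → Bool) (X Y : Matrix m N) where

  ValidEntry : Fin m × Fin N → Set
  ValidEntry (i , j) =
      (bᵢ <ᵇ aᵢ × Yᵢⱼ <ᵇ Xᵢⱼ)
    ⊎ (aᵢ <ᵇ bᵢ × Xᵢⱼ <ᵇ Yᵢⱼ)
    ⊎ (aᵢ ≡ bᵢ × Xᵢⱼ ≢ Yᵢⱼ)
    where
    aᵢ bᵢ Xᵢⱼ Yᵢⱼ : Bool
    aᵢ  = lookup (map g X) i
    bᵢ  = lookup (map g Y) i
    Xᵢⱼ = lookup (lookup X i) j
    Yᵢⱼ = lookup (lookup Y i) j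

U_⋄mKW_ : ∀ (m : ℕ) {N} → (Vec Bool N → Bool) → CommunicationProblem
U_⋄mKW_ m {N} g = record
  { AliceInput = Matrix m N
  ; BobInput   = Matrix m N
  ; Output     = Fin m × Fin N
  ; Promise    = λ X Y → map g X ≢ map g Y
  ; Valid      = ValidEntry g
  }

-- The real inequality d ≥ m + κ n^{1/6} for κ = 1/c (c ≥ 1), with roots and
-- denominators cleared.  Reciprocals suffice for "some absolute κ > 0", since
-- the inequality for κ implies it for every smaller constant.
AtLeastPlusSixthRoot : (c m n d : ℕ) → Set
AtLeastPlusSixthRoot c m n d = m ≤ d × n ≤ (c * (d ∸ m)) ^ 6

{-# OPTIONS --safe #-}
-- Since n may depend on m, it suffices to bound the depth for Gen alone, played in the first row
-- with the other rows equal.  Colour the vertices of a pyramid of height h with ℓ colours.  For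
-- colourings x and y, Alice's triplets derive, from the coloured predecessors of each vertex v, the
-- point (v , xᵥ); Bob's are all triplets that do not leave the set of the points (v , yᵥ).  Over
-- GF(2) let A[x,y] be the sum, over the pebble placements S that do not block the apex, of
-- ∏_{v ∉ S} [xᵥ ≠ yᵥ].  A protocol cuts A into at most 2^d rectangles.  In the rectangle of a
-- triplet deriving the colours of w, the terms S and S ∪ {w} cancel unless w blocks the apex: this
-- never happens above the bottom row, and takes h pebbles otherwise, so that the rank of every
-- rectangle is at most (ℓ + 2)^V / 2^h.  But A differs from the identity, which is the sum over all
-- S, by terms with S ≠ ∅, so its rank is comparable to ℓ^V and d ≥ h − 2.  Here V ≈ h² and ℓ = 6 V
-- suffice, which fits into h⁶ points.
module Submission where

open import Defs
import Data.Bool.Base as Bool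
open import Data.Bool.Base using (Bool; true; false; not; _∧_; _∨_; _xor_; if_then_else_)
open import Data.Bool.Properties using (if-float; ∧-assoc; ∧-comm; ∧-zeroʳ; ∧-identityʳ; ∨-zeroʳ; ∧-distribˡ-xor; xor-assoc; xor-identityʳ; xor-same; xor-∧-commutativeRing)
open import Data.Fin.Base using (Fin; zero; suc; toℕ; fromℕ; fromℕ<; combine; remQuot; _↑ˡ_; _↑ʳ_; splitAt; finToFun; funToFin)
open import Data.Fin.Properties using (_≟_; suc-injective; toℕ-fromℕ<; combine-injective; remQuot-combine; splitAt-↑ˡ; splitAt-↑ʳ; ↑ˡ-injective; toℕ-↑ʳ; toℕ-fromℕ; toℕ-injective; toℕ<n; any?; injective⇒≤; funToFin-finToFin; finToFun-funToFin)
open import Data.Fin.Subset using (Subset; ⊥; ∣_∣)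
open import Data.Nat.Base using (ℕ; NonZero; zero; suc; _+_; _*_; _∸_; _^_; _⊔_; _⊓_; pred; _≤_; _<_; >-nonZero; z≤n; s≤s)
open import Data.Nat.Properties hiding (_≟_; suc-injective)
open import Data.Nat.Tactic.RingSolver using (solve-∀)
open import Data.Product.Base using (∃-syntax; _×_; _,_; proj₁; proj₂; map₂)
open import Data.Sum.Base using (_⊎_; inj₁; inj₂)
open import Data.Vec.Base using (Vec; []; _∷_; _++_; head; tail; lookup; map; replicate; zipWith; tabulate; _[_]≔_)
open import Data.Vec.Properties using (tabulate∘lookup; lookup∘tabulate; tabulate-cong; lookup-replicate; lookup∘update; lookup∘update′)
open import Function.Base using (_∘_; _⟨_⟩_)
open import Relation.Binary.PropositionalEquality
open import Relation.Nullary.Decidable using (Dec; yes; no; does; dec-true; dec-false; decidable-stable; ¬?; _×-dec_; _⊎-dec_)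
open import Relation.Nullary.Negation using (¬_; contradiction)
open import Algebra.Bundles using (CommutativeRing)
open import Algebra.Properties.CommutativeSemigroup (CommutativeRing.+-commutativeSemigroup xor-∧-commutativeRing) using () renaming (interchange to xor-interchange)
open import Algebra.Properties.CommutativeSemigroup *-commutativeSemigroup using (x∙yz≈y∙xz)

-- Rank over GF(2)

infix 7 _·_
_·_ : ∀ {k} → Vec Bool k → Vec Bool k → Bool
[]       · []       = false
(a ∷ as) · (b ∷ bs) = (a ∧ b) xor (as · bs)

·-++ : ∀ {k l} (a b : Vec Bool k) {c d : Vec Bool l} → (a ++ c) · (b ++ d) ≡ (a · b) xor (c · d)
·-++ []       []       = refl
·-++ (a ∷ as) (b ∷ bs) {c} {d} =
  trans (cong ((a ∧ b) xor_) (·-++ as bs)) (sym (xor-assoc (a ∧ b) (as · bs) (c · d)))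

·-zeroˡ : ∀ {k} (b : Vec Bool k) → replicate k false · b ≡ false
·-zeroˡ []       = refl
·-zeroˡ (b ∷ bs) = ·-zeroˡ bs

·-scaleˡ : ∀ {k} c (a b : Vec Bool k) → map (c ∧_) a · b ≡ c ∧ (a · b)
·-scaleˡ c []       []       = sym (∧-zeroʳ c)
·-scaleˡ c (a ∷ as) (b ∷ bs) = trans
  (cong₂ _xor_ (∧-assoc c a b) (·-scaleˡ c as bs))
  (sym (∧-distribˡ-xor c (a ∧ b) (as · bs)))

·-comm : ∀ {k} (a b : Vec Bool k) → a · b ≡ b · a
·-comm []       []       = refl
·-comm (a ∷ as) (b ∷ bs) = cong₂ _xor_ (∧-comm a b) (·-comm as bs)

·-distribʳ : ∀ {k} (a b c : Vec Bool k) → zipWith _xor_ a b · c ≡ (a · c) xor (b · c)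
·-distribʳ []       []       []       = refl
·-distribʳ (a ∷ as) (b ∷ bs) (c ∷ cs) = trans
  (cong₂ _xor_ (distrib a b c) (·-distribʳ as bs cs))
  (xor-interchange (a ∧ c) (b ∧ c) (as · cs) (bs · cs))
  where
  distrib : ∀ a b c → (a xor b) ∧ c ≡ (a ∧ c) xor (b ∧ c)
  distrib a b c = trans (∧-comm (a xor b) c)
    (trans (∧-distribˡ-xor c a b) (cong₂ _xor_ (∧-comm c a) (∧-comm c b)))

if-xor : ∀ b {m n} → (if b then m else n) ≡ (b ∧ m) xor (not b ∧ n)
if-xor true  = sym (xor-identityʳ _)
if-xor false = refl

-- An explicit factorisation through GF(2)^k, so that ranks of sums and restrictions are bounded by
-- building new vectors.
record Rank≤ {X Y : Set} (M : X → Y → Bool) (k : ℕ) : Set where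
  constructor factors
  field
    row    : X → Vec Bool k
    column : Y → Vec Bool k
    factor : ∀ x y → M x y ≡ row x · column y

open Rank≤

module _ {X Y : Set} where

  rank-cong : ∀ {M N : X → Y → Bool} {k} → (∀ x y → N x y ≡ M x y) → Rank≤ M k → Rank≤ N k
  rank-cong e R = factors (row R) (column R) λ x y → trans (e x y) (factor R x y)

  rank-false : Rank≤ {X} {Y} (λ _ _ → false) 0
  rank-false = factors (λ _ → []) (λ _ → []) λ _ _ → refl

  rank-true : Rank≤ {X} {Y} (λ _ _ → true) 1
  rank-true = factors (λ _ → true ∷ []) (λ _ → true ∷ []) λ _ _ → refl

  rank-xor : ∀ {M N : X → Y → Bool} {k l} → Rank≤ M k → Rank≤ N l →
    Rank≤ (λ x y → M x y xor N x y) (k + l)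
  rank-xor R S = factors (λ x → row R x ++ row S x) (λ y → column R y ++ column S y) λ x y →
    trans (cong₂ _xor_ (factor R x y) (factor S x y)) (sym (·-++ (row R x) (column R y)))

  rank-scaleˡ : ∀ {M : X → Y → Bool} {k} (f : X → Bool) → Rank≤ M k →
    Rank≤ (λ x y → f x ∧ M x y) k
  rank-scaleˡ f R = factors (λ x → map (f x ∧_) (row R x)) (column R) λ x y →
    trans (cong (f x ∧_) (factor R x y)) (sym (·-scaleˡ (f x) (row R x) (column R y)))

  rank-scaleʳ : ∀ {M : X → Y → Bool} {k} (f : Y → Bool) → Rank≤ M k →
    Rank≤ (λ x y → f y ∧ M x y) k
  rank-scaleʳ f R = factors (row R) (λ y → map (f y ∧_) (column R y)) λ x y → begin
      _                                          ≡⟨ cong (f y ∧_) (trans (factor R x y) (·-comm (row R x) (column R y))) ⟩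
      f y ∧ (column R y · row R x)               ≡⟨ ·-scaleˡ (f y) (column R y) (row R x) ⟨
      map (f y ∧_) (column R y) · row R x        ≡⟨ ·-comm _ (row R x) ⟩
      row R x · map (f y ∧_) (column R y)        ∎
    where open ≡-Reasoning

  rank-ifˡ : ∀ {M N : X → Y → Bool} {k l} (f : X → Bool) → Rank≤ M k → Rank≤ N l →
    Rank≤ (λ x y → if f x then M x y else N x y) (k + l)
  rank-ifˡ f R S = rank-cong (λ x y → if-xor (f x))
    (rank-xor (rank-scaleˡ f R) (rank-scaleˡ (not ∘ f) S))

  rank-ifʳ : ∀ {M N : X → Y → Bool} {k l} (f : Y → Bool) → Rank≤ M k → Rank≤ N l →
    Rank≤ (λ x y → if f y then M x y else N x y) (k + l)
  rank-ifʳ f R S = rank-cong (λ x y → if-xor (f y))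
    (rank-xor (rank-scaleʳ f R) (rank-scaleʳ (not ∘ f) S))

  -- The row vector of x sits in block `κ x`, with zeros elsewhere, and the column vectors of all
  -- cases are stacked; the product then sees only the case `κ x`.
  rank-case : ∀ {k} ℓ (κ : X → Fin ℓ) {M : Fin ℓ → X → Y → Bool} → (∀ c → Rank≤ (M c) k) →
    Rank≤ (λ x y → M (κ x) x y) (ℓ * k)
  rank-case {k} ℓ κ R = factors
    (λ x → block (κ x) (row (R (κ x)) x))
    (λ y → blocks λ c → column (R c) y)
    λ x y → trans (factor (R (κ x)) x y) (sym (block-· (κ x) (row (R (κ x)) x) (λ c → column (R c) y)))
    where
    block : ∀ {ℓ} → Fin ℓ → Vec Bool k → Vec Bool (ℓ * k)
    block {suc ℓ} zero    a = a ++ replicate (ℓ * k) false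
    block {suc ℓ} (suc c) a = replicate k false ++ block c a

    blocks : ∀ {ℓ} → (Fin ℓ → Vec Bool k) → Vec Bool (ℓ * k)
    blocks {zero}  b = []
    blocks {suc ℓ} b = b zero ++ blocks (b ∘ suc)

    block-· : ∀ {ℓ} c a (b : Fin ℓ → Vec Bool k) → block c a · blocks b ≡ a · b c
    block-· {suc ℓ} zero    a b = trans (·-++ a (b zero))
      (trans (cong ((a · b zero) xor_) (·-zeroˡ (blocks (b ∘ suc)))) (xor-identityʳ _))
    block-· {suc ℓ} (suc c) a b = trans (·-++ (replicate k false) (b zero))
      (trans (cong (_xor (block c a · blocks (b ∘ suc))) (·-zeroˡ (b zero))) (block-· c a (b ∘ suc)))

rank-reindex : ∀ {X Y X′ Y′ : Set} {M : X → Y → Bool} {k} (f : X′ → X) (g : Y′ → Y) →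
  Rank≤ M k → Rank≤ (λ x y → M (f x) (g y)) k
rank-reindex f g R = factors (row R ∘ f) (column R ∘ g) λ x y → factor R (f x) (g y)

-- Coding bit vectors as numbers, for counting.

private
  bit : Bool → Fin 2
  bit false = zero
  bit true  = suc zero

  unbit : Fin 2 → Bool
  unbit zero       = false
  unbit (suc zero) = true

  unbit-bit : ∀ b → unbit (bit b) ≡ b
  unbit-bit false = refl
  unbit-bit true  = refl

  unbit-injective : ∀ {i j} → unbit i ≡ unbit j → i ≡ j
  unbit-injective {zero}     {zero}     _ = refl
  unbit-injective {zero}     {suc zero} ()
  unbit-injective {suc zero} {zero}     ()
  unbit-injective {suc zero} {suc zero} _ = refl

funToFin-cong : ∀ {m n} {f g : Fin n → Fin m} → (∀ k → f k ≡ g k) → funToFin f ≡ funToFin g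
funToFin-cong {n = zero}  e = refl
funToFin-cong {n = suc n} e = cong₂ combine (e zero) (funToFin-cong (e ∘ suc))

finToFun-injective : ∀ m n {i j : Fin (m ^ n)} → (∀ k → finToFun {m} {n} i k ≡ finToFun j k) → i ≡ j
finToFun-injective m n {i} {j} e = trans (sym (funToFin-finToFin {n} {m} i))
  (trans (funToFin-cong {m} {n} e) (funToFin-finToFin {n} {m} j))

combination : ∀ {N k} → (Fin N → Bool) → (Fin N → Vec Bool k) → Vec Bool k
combination {zero}  {k} s v = replicate k false
combination {suc N}     s v = zipWith _xor_ (map (s zero ∧_) (v zero)) (combination (s ∘ suc) (v ∘ suc))

combination-· : ∀ {N k} s (v : Fin (suc N) → Vec Bool k) b →
  combination s v · b ≡ (s zero ∧ (v zero · b)) xor (combination (s ∘ suc) (v ∘ suc) · b)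
combination-· s v b = trans (·-distribʳ (map (s zero ∧_) (v zero)) _ b)
  (cong (_xor (combination (s ∘ suc) (v ∘ suc) · b)) (·-scaleˡ (s zero) (v zero) b))

combination-false : ∀ {N k} s (v : Fin N → Vec Bool k) b → (∀ i → v i · b ≡ false) →
  combination s v · b ≡ false
combination-false {zero}  s v b e = ·-zeroˡ b
combination-false {suc N} s v b e = trans (combination-· s v b)
  (cong₂ _xor_ (trans (cong (s zero ∧_) (e zero)) (∧-zeroʳ (s zero)))
               (combination-false (s ∘ suc) (v ∘ suc) b (e ∘ suc)))

-- A vector `b` dual to `v j` reads off the coefficient of `v j`; hence combinations with different
-- coefficients differ.
combination-dual : ∀ {N k} s (v : Fin N → Vec Bool k) b j → v j · b ≡ true →
  (∀ i → i ≢ j → v i · b ≡ false) → combination s v · b ≡ s j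
combination-dual s v b zero hit miss = trans (combination-· s v b) (trans
  (cong₂ _xor_ (trans (cong (s zero ∧_) hit) (∧-identityʳ (s zero)))
               (combination-false (s ∘ suc) (v ∘ suc) b λ i → miss (suc i) λ ()))
  (xor-identityʳ (s zero)))
combination-dual s v b (suc j) hit miss = trans (combination-· s v b)
  (cong₂ _xor_ (trans (cong (s zero ∧_) (miss zero λ ())) (∧-zeroʳ (s zero)))
               (combination-dual (s ∘ suc) (v ∘ suc) b j hit λ i i≢j → miss (suc i) (i≢j ∘ suc-injective)))

-- The 2^N combinations of the rows are pairwise distinct vectors of GF(2)^k.
rank-identity : ∀ {N k} {M : Fin N → Fin N → Bool} → Rank≤ M k →
  (∀ i → M i i ≡ true) → (∀ {i j} → i ≢ j → M i j ≡ false) → N ≤ k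
rank-identity {N} {k} R diagonal off =
  ≮⇒≥ λ k<N → <⇒≱ (^-monoʳ-< 2 (s≤s (s≤s z≤n)) k<N) (injective⇒≤ {f = code} code-injective)
  where
  coefficient : Fin (2 ^ N) → Fin N → Bool
  coefficient s i = unbit (finToFun {2} {N} s i)

  code : Fin (2 ^ N) → Fin (2 ^ k)
  code s = funToFin (bit ∘ lookup (combination (coefficient s) (row R)))

  recover : ∀ s j → combination (coefficient s) (row R) · column R j ≡ coefficient s j
  recover s j = combination-dual (coefficient s) (row R) (column R j) j
    (trans (sym (factor R j j)) (diagonal j)) λ i i≢j → trans (sym (factor R i j)) (off i≢j)

  combination≡ : ∀ {s t} → code s ≡ code t →
    combination (coefficient s) (row R) ≡ combination (coefficient t) (row R)
  combination≡ {s} {t} e = trans (sym (tabulate∘lookup _)) (trans (tabulate-cong entry) (tabulate∘lookup _))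
    where
    decoded : ∀ s i → unbit (finToFun {2} {k} (code s) i) ≡ lookup (combination (coefficient s) (row R)) i
    decoded s i = trans (cong unbit (finToFun-funToFin {k} {2} _ i)) (unbit-bit _)
    entry : ∀ i → lookup (combination (coefficient s) (row R)) i ≡ lookup (combination (coefficient t) (row R)) i
    entry i = trans (sym (decoded s i)) (trans (cong (λ c → unbit (finToFun {2} {k} c i)) e) (decoded t i))

  code-injective : ∀ {s t} → code s ≡ code t → s ≡ t
  code-injective {s} {t} e = finToFun-injective 2 N λ j → unbit-injective
    (trans (sym (recover s j)) (trans (cong (_· column R j) (combination≡ e)) (recover t j)))

-- Inequality polynomials

unequal : ∀ {ℓ} → Fin ℓ → Fin ℓ → Bool
unequal a b = not (does (a ≟ b))

-- subsetSum φ x y is the sum over φ S of the products over i ∉ S of [xᵢ ≠ yᵢ].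
subsetSum : ∀ {ℓ V} → (Subset V → Bool) → Vec (Fin ℓ) V → Vec (Fin ℓ) V → Bool
subsetSum φ []       []       = φ []
subsetSum φ (x ∷ xs) (y ∷ ys) =
  subsetSum (φ ∘ (true ∷_)) xs ys xor (unequal x y ∧ subsetSum (φ ∘ (false ∷_)) xs ys)

-- What remains of `φ` when the terms of S and of S without w coincide: a pair lying wholly inside
-- or wholly outside `φ` cancels, and any other pair is represented by its member containing w.
∂ : ∀ {V} → Fin V → (Subset V → Bool) → Subset V → Bool
∂ w φ S = lookup S w ∧ (φ S xor φ (S [ w ]≔ false))

-- The sum over φ S of ℓ ^ (V ∸ ∣ S ∣).
weight : ∀ ℓ {V} → (Subset V → Bool) → ℕ
weight ℓ {zero}  φ = if φ [] then 1 else 0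
weight ℓ {suc V} φ = weight ℓ (φ ∘ (true ∷_)) + ℓ * weight ℓ (φ ∘ (false ∷_))

module _ {ℓ : ℕ} where

  -- The term of S sees x only through its colours off S, which take ℓ ^ (V ∸ ∣ S ∣) values; once
  -- they are fixed, a function of y alone is left.
  subsetSum-rank : ∀ {V} (φ : Subset V → Bool) → Rank≤ (subsetSum {ℓ} φ) (weight ℓ φ)
  subsetSum-rank {zero} φ with φ [] in eq
  ... | true  = rank-cong (λ { [] [] → eq }) rank-true
  ... | false = rank-cong (λ { [] [] → eq }) rank-false
  subsetSum-rank {suc V} φ = rank-cong (λ { (_ ∷ _) (_ ∷ _) → refl })
    (rank-xor (rank-reindex tail tail (subsetSum-rank (φ ∘ (true ∷_))))
      (rank-case ℓ head {M = λ c xs ys → unequal c (head ys) ∧ subsetSum (φ ∘ (false ∷_)) (tail xs) (tail ys)}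
        λ c → rank-scaleʳ (λ ys → unequal c (head ys)) (rank-reindex tail tail (subsetSum-rank (φ ∘ (false ∷_))))))

  subsetSum-cong : ∀ {V} {φ ψ : Subset V → Bool} → (∀ S → φ S ≡ ψ S) → ∀ (x y : Vec (Fin ℓ) V) →
    subsetSum φ x y ≡ subsetSum ψ x y
  subsetSum-cong e []       []       = e []
  subsetSum-cong e (x ∷ xs) (y ∷ ys) = cong₂ (λ a b → a xor (unequal x y ∧ b))
    (subsetSum-cong (e ∘ (true ∷_)) xs ys) (subsetSum-cong (e ∘ (false ∷_)) xs ys)

  subsetSum-false : ∀ {V} (x y : Vec (Fin ℓ) V) → subsetSum (λ _ → false) x y ≡ false
  subsetSum-false []       []       = refl
  subsetSum-false (x ∷ xs) (y ∷ ys) = trans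
    (cong₂ (λ a b → a xor (unequal x y ∧ b)) (subsetSum-false xs ys) (subsetSum-false xs ys))
    (∧-zeroʳ (unequal x y))

  subsetSum-xor : ∀ {V} (φ ψ : Subset V → Bool) (x y : Vec (Fin ℓ) V) →
    subsetSum (λ S → φ S xor ψ S) x y ≡ subsetSum φ x y xor subsetSum ψ x y
  subsetSum-xor φ ψ []       []       = refl
  subsetSum-xor φ ψ (x ∷ xs) (y ∷ ys) = trans
    (cong₂ (λ a b → a xor (z ∧ b)) (subsetSum-xor _ _ xs ys) (subsetSum-xor _ _ xs ys))
    (trans (cong ((φ₁ xor ψ₁) xor_) (∧-distribˡ-xor z φ₀ ψ₀))
           (xor-interchange φ₁ ψ₁ (z ∧ φ₀) (z ∧ ψ₀)))
    where
    z φ₀ φ₁ ψ₀ ψ₁ : Bool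
    z  = unequal x y
    φ₀ = subsetSum (φ ∘ (false ∷_)) xs ys
    φ₁ = subsetSum (φ ∘ (true ∷_)) xs ys
    ψ₀ = subsetSum (ψ ∘ (false ∷_)) xs ys
    ψ₁ = subsetSum (ψ ∘ (true ∷_)) xs ys

  unequal-≡ : ∀ {a b : Fin ℓ} → a ≡ b → unequal a b ≡ false
  unequal-≡ {a} {b} e = cong not (dec-true (a ≟ b) e)

  unequal-≢ : ∀ {a b : Fin ℓ} → a ≢ b → unequal a b ≡ true
  unequal-≢ {a} {b} e = cong not (dec-false (a ≟ b) e)

  -- Over all S the sum factors into the product of the 1 + [xᵢ ≠ yᵢ] = [xᵢ = yᵢ].
  subsetSum-true-≡ : ∀ {V} (x : Vec (Fin ℓ) V) → subsetSum (λ _ → true) x x ≡ true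
  subsetSum-true-≡ []       = refl
  subsetSum-true-≡ (x ∷ xs) rewrite unequal-≡ {x} refl =
    trans (xor-identityʳ _) (subsetSum-true-≡ xs)

  subsetSum-true-≢ : ∀ {V} {x y : Vec (Fin ℓ) V} → x ≢ y → subsetSum (λ _ → true) x y ≡ false
  subsetSum-true-≢ {x = []} {[]} x≢y = contradiction refl x≢y
  subsetSum-true-≢ {x = x ∷ xs} {y ∷ ys} x≢y with x ≟ y
  ... | yes refl = trans (xor-identityʳ _) (subsetSum-true-≢ (x≢y ∘ cong (x ∷_)))
  ... | no  _    = xor-same (subsetSum (λ _ → true) xs ys)

  -- Every term with v ∉ S contains the vanishing factor [xᵥ ≠ yᵥ].
  subsetSum-equal : ∀ {V} {φ ψ : Subset V → Bool} (x y : Vec (Fin ℓ) V) v → lookup x v ≡ lookup y v →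
    (∀ S → lookup S v ≡ true → φ S ≡ ψ S) → subsetSum φ x y ≡ subsetSum ψ x y
  subsetSum-equal (x ∷ xs) (y ∷ ys) zero e φ≡ψ rewrite unequal-≡ e =
    cong (_xor false) (subsetSum-cong (λ S → φ≡ψ (true ∷ S) refl) xs ys)
  subsetSum-equal (x ∷ xs) (y ∷ ys) (suc v) e φ≡ψ = cong₂ (λ a b → a xor (unequal x y ∧ b))
    (subsetSum-equal xs ys v e (φ≡ψ ∘ (true ∷_))) (subsetSum-equal xs ys v e (φ≡ψ ∘ (false ∷_)))

  -- The factor at w is 1, so that the terms of S and S ∪ {w} are equal and cancel whenever both
  -- occur.
  subsetSum-unequal : ∀ {V} (φ : Subset V → Bool) (x y : Vec (Fin ℓ) V) w → lookup x w ≢ lookup y w →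
    subsetSum φ x y ≡ subsetSum (∂ w φ) x y
  subsetSum-unequal φ (x ∷ xs) (y ∷ ys) zero x≢y rewrite unequal-≢ x≢y = sym (trans
    (cong₂ _xor_ (subsetSum-xor (φ ∘ (true ∷_)) (φ ∘ (false ∷_)) xs ys) (subsetSum-false xs ys))
    (xor-identityʳ _))
  subsetSum-unequal φ (x ∷ xs) (y ∷ ys) (suc w) x≢y = cong₂ (λ a b → a xor (unequal x y ∧ b))
    (subsetSum-unequal (φ ∘ (true ∷_)) xs ys w x≢y) (subsetSum-unequal (φ ∘ (false ∷_)) xs ys w x≢y)

-- By the binomial theorem ℓ ^ (V ∸ ∣ S ∣) * q ^ ∣ S ∣ sums to (ℓ + q) ^ V over all S, and q ^ D ≤ q
-- ^ ∣ S ∣ for the S counted.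
weight-large : ∀ ℓ q .{{_ : NonZero q}} {V} D (φ : Subset V → Bool) →
  (∀ S → φ S ≡ true → D ≤ ∣ S ∣) → weight ℓ φ * q ^ D ≤ (ℓ + q) ^ V
weight-large ℓ q {zero} D φ large with φ [] in eq
... | false = z≤n
... | true  with z≤n ← large [] eq = ≤-refl
weight-large ℓ q {suc V} D φ large = begin
    (weight ℓ φ₁ + ℓ * weight ℓ φ₀) * q ^ D           ≡⟨ *-distribʳ-+ (q ^ D) (weight ℓ φ₁) (ℓ * weight ℓ φ₀) ⟩
    weight ℓ φ₁ * q ^ D + ℓ * weight ℓ φ₀ * q ^ D     ≤⟨ +-mono-≤ (with-element D large) without-element ⟩
    q * (ℓ + q) ^ V + ℓ * (ℓ + q) ^ V                 ≡⟨ *-distribʳ-+ ((ℓ + q) ^ V) q ℓ ⟨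
    (q + ℓ) * (ℓ + q) ^ V                             ≡⟨ cong (_* (ℓ + q) ^ V) (+-comm q ℓ) ⟩
    (ℓ + q) * (ℓ + q) ^ V                             ∎
  where
  open ≤-Reasoning
  φ₀ φ₁ : Subset V → Bool
  φ₀ = φ ∘ (false ∷_)
  φ₁ = φ ∘ (true ∷_)
  with-element : ∀ D → (∀ S → φ S ≡ true → D ≤ ∣ S ∣) → weight ℓ φ₁ * q ^ D ≤ q * (ℓ + q) ^ V
  with-element zero    large = ≤-trans (weight-large ℓ q 0 φ₁ λ _ _ → z≤n) (m≤n*m _ q)
  with-element (suc D) large = begin
    weight ℓ φ₁ * (q * q ^ D)   ≡⟨ x∙yz≈y∙xz (weight ℓ φ₁) q (q ^ D) ⟩
    q * (weight ℓ φ₁ * q ^ D)   ≤⟨ *-monoʳ-≤ q (weight-large ℓ q D φ₁ λ S e → ≤-pred (large (true ∷ S) e)) ⟩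
    q * (ℓ + q) ^ V             ∎
  without-element : ℓ * weight ℓ φ₀ * q ^ D ≤ ℓ * (ℓ + q) ^ V
  without-element = begin
    ℓ * weight ℓ φ₀ * q ^ D     ≡⟨ *-assoc ℓ (weight ℓ φ₀) (q ^ D) ⟩
    ℓ * (weight ℓ φ₀ * q ^ D)   ≤⟨ *-monoʳ-≤ ℓ (weight-large ℓ q D φ₀ λ S → large (false ∷ S)) ⟩
    ℓ * (ℓ + q) ^ V             ∎

-- All S together weigh (ℓ + 1) ^ V, of which the empty set contributes ℓ ^ V.
weight-∌∅ : ∀ ℓ {V} (φ : Subset V → Bool) → φ ⊥ ≡ false → weight ℓ φ + ℓ ^ V ≤ (ℓ + 1) ^ V
weight-∌∅ ℓ {zero}  φ e rewrite e = ≤-refl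
weight-∌∅ ℓ {suc V} φ e = begin
    weight ℓ φ₁ + ℓ * weight ℓ φ₀ + ℓ * ℓ ^ V      ≡⟨ +-assoc (weight ℓ φ₁) _ _ ⟩
    weight ℓ φ₁ + (ℓ * weight ℓ φ₀ + ℓ * ℓ ^ V)    ≡⟨ cong (weight ℓ φ₁ +_) (*-distribˡ-+ ℓ (weight ℓ φ₀) (ℓ ^ V)) ⟨
    weight ℓ φ₁ + ℓ * (weight ℓ φ₀ + ℓ ^ V)        ≤⟨ +-mono-≤ bound (*-monoʳ-≤ ℓ (weight-∌∅ ℓ φ₀ e)) ⟩
    (ℓ + 1) ^ V + ℓ * (ℓ + 1) ^ V                  ≡⟨ cong (_* (ℓ + 1) ^ V) (+-comm 1 ℓ) ⟩
    (ℓ + 1) * (ℓ + 1) ^ V                          ∎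
  where
  open ≤-Reasoning
  φ₀ φ₁ : Subset V → Bool
  φ₀ = φ ∘ (false ∷_)
  φ₁ = φ ∘ (true ∷_)
  bound : weight ℓ φ₁ ≤ (ℓ + 1) ^ V
  bound = ≤-trans (≤-reflexive (sym (*-identityʳ _))) (weight-large ℓ 1 0 φ₁ λ _ _ → z≤n)

-- Pebbled pyramids

-- Blocking: true iff every path from the bottom row up to (k , j), endpoints included, meets a
-- pebble.
closure : (ℕ → ℕ → Bool) → ℕ → ℕ → Bool
closure s zero    j = s zero j
closure s (suc k) j = s (suc k) j ∨ (closure s k j ∧ closure s k (suc j))

module _ {s t : ℕ → ℕ → Bool} where

  -- Only the cone below (k , j) matters; the two inequalities on k′ and j′ describe that cone.
  closure-cong : ∀ k j → (∀ k′ j′ → j ≤ j′ → k′ + j′ ≤ k + j → s k′ j′ ≡ t k′ j′) →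
    closure s k j ≡ closure t k j
  closure-cong zero    j e = e zero j ≤-refl ≤-refl
  closure-cong (suc k) j e = cong₂ _∨_ (e (suc k) j ≤-refl ≤-refl) (cong₂ _∧_
    (closure-cong k j λ k′ j′ l r → e k′ j′ l (m≤n⇒m≤1+n r))
    (closure-cong k (suc j) λ k′ j′ l r → e k′ j′ (<⇒≤ l) (≤-trans r (≤-reflexive (+-suc k j)))))

module _ {s : ℕ → ℕ → Bool} where

  closure-∋ : ∀ k j → s k j ≡ true → closure s k j ≡ true
  closure-∋ zero    j e = e
  closure-∋ (suc k) j e = cong (_∨ (closure s k j ∧ closure s k (suc j))) e

  closure-∅ : (∀ k j → s k j ≡ false) → ∀ k j → closure s k j ≡ false
  closure-∅ e zero    j = e zero j
  closure-∅ e (suc k) j = cong₂ _∨_ (e (suc k) j) (cong (_∧ closure s k (suc j)) (closure-∅ e k j))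

  -- The left side of the cone is one of the paths that must meet a pebble; `closure-right` uses the
  -- right side.
  closure-left : ∀ k j → closure s k j ≡ true → ∃[ k′ ] (k′ ≤ k × s k′ j ≡ true)
  closure-left zero    j e = zero , z≤n , e
  closure-left (suc k) j e with s (suc k) j in here | closure s k j in left
  ... | true  | _    = suc k , ≤-refl , here
  ... | false | true with k′ , k′≤k , e′ ← closure-left k j left = k′ , m≤n⇒m≤1+n k′≤k , e′

  closure-right : ∀ k j → closure s k j ≡ true → ∃[ k′ ] ∃[ j′ ] (k′ + j′ ≡ k + j × s k′ j′ ≡ true)
  closure-right zero    j e = zero , j , refl , e
  closure-right (suc k) j e with s (suc k) j in here | closure s k j | closure s k (suc j) in right
  ... | true  | _    | _    = suc k , j , refl , here
  ... | false | true | true with k′ , j′ , sum , e′ ← closure-right k (suc j) right =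
    k′ , j′ , trans sum (+-suc k j) , e′

size-remove : ∀ {V} (S : Subset V) v → lookup S v ≡ true → suc ∣ S [ v ]≔ false ∣ ≡ ∣ S ∣
size-remove (true  ∷ S) zero    e = refl
size-remove (true  ∷ S) (suc v) e = cong suc (size-remove S v e)
size-remove (false ∷ S) (suc v) e = size-remove S v e

clamp : ∀ h → ℕ → Fin (suc h)
clamp h k = fromℕ< {k ⊓ h} (s≤s (m⊓n≤n k h))

toℕ-clamp : ∀ {h k} → k ≤ h → toℕ (clamp h k) ≡ k
toℕ-clamp {h} {k} k≤h = trans (toℕ-fromℕ< (s≤s (m⊓n≤n k h))) (m≤n⇒m⊓n≡m k≤h)

-- Vertex (k , j) of the pyramid lies at height k; its predecessors are (k − 1 , j) and
-- (k − 1 , j + 1).  Only the (k , j) with k + j ≤ h belong to the pyramid with apex (h , 0):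
-- the other cells of the square are isolated, and `vertex` is not injective beyond the square.
module Pyramid (h : ℕ) where

  abstract

    size : ℕ
    size = suc h * suc h

    size-≡ : size ≡ suc h * suc h
    size-≡ = refl

    vertex : ℕ → ℕ → Fin size
    vertex k j = combine (clamp h k) (clamp h j)

    vertex-injective : ∀ k j k′ j′ → k + j ≤ h → k′ + j′ ≤ h → vertex k j ≡ vertex k′ j′ → k ≡ k′ × j ≡ j′
    vertex-injective k j k′ j′ p p′ e
      with e₁ , e₂ ← combine-injective (clamp h k) (clamp h j) (clamp h k′) (clamp h j′) e =
        unclamp (m+n≤o⇒m≤o k p) (m+n≤o⇒m≤o k′ p′) e₁ , unclamp (m+n≤o⇒n≤o k p) (m+n≤o⇒n≤o k′ p′) e₂
      where
      unclamp : ∀ {a b} → a ≤ h → b ≤ h → clamp h a ≡ clamp h b → a ≡ b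
      unclamp a≤h b≤h e = trans (sym (toℕ-clamp a≤h)) (trans (cong toℕ e) (toℕ-clamp b≤h))

  apex : Fin size
  apex = vertex h 0

  pebbled : Subset size → ℕ → ℕ → Bool
  pebbled S k j = lookup S (vertex k j)

  unblocked : Subset size → Bool
  unblocked S = not (closure (pebbled S) h 0)

  unblocked-⊥ : unblocked ⊥ ≡ true
  unblocked-⊥ = cong not (closure-∅ (λ k j → lookup-replicate (vertex k j) false) h 0)

  unblocked-apex : ∀ S → lookup S apex ≡ true → unblocked S ≡ false
  unblocked-apex S e = cong not (closure-∋ h 0 e)

  -- Placements that differ in at most one vertex.

  record AgreeOff (w : Fin size) (S T : Subset size) : Set where
    constructor agreeOff
    field
      at : ∀ v → v ≢ w → lookup S v ≡ lookup T v

  open AgreeOff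

  agreeOff-remove : ∀ {w S T} u → AgreeOff w S T → AgreeOff w (S [ u ]≔ false) (T [ u ]≔ false)
  at (agreeOff-remove {w} {S} {T} u agree) v v≢w with v ≟ u
  ... | yes refl = trans (lookup∘update u S false) (sym (lookup∘update u T false))
  ... | no  v≢u  = trans (lookup∘update′ v≢u S false) (trans (at agree v v≢w) (sym (lookup∘update′ v≢u T false)))

  agreeOff-sym : ∀ {w S T} → AgreeOff w S T → AgreeOff w T S
  at (agreeOff-sym agree) v v≢w = sym (at agree v v≢w)

  remove-agreeOff : ∀ S w → AgreeOff w S (S [ w ]≔ false)
  at (remove-agreeOff S w) v v≢w = sym (lookup∘update′ v≢w S false)

  private
    Avoids : ℕ → ℕ → Fin size → Set
    Avoids k j u = ∀ k′ j′ → j ≤ j′ → k′ + j′ ≤ k + j → vertex k′ j′ ≢ u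

    closure-agreeOff : ∀ {w S T} k j → AgreeOff w S T → Avoids k j w →
      closure (pebbled S) k j ≡ closure (pebbled T) k j
    closure-agreeOff k j agree avoids =
      closure-cong k j λ k′ j′ l r → at agree (vertex k′ j′) (avoids k′ j′ l r)

  module _ {w : Fin size} (bottom : ∀ {k j} → suc k + j ≤ h → vertex (suc k) j ≢ w) where

    private
      Bottleneck : ℕ → ℕ → Set
      Bottleneck k j = ∀ {S T} → AgreeOff w S T →
        closure (pebbled S) k j ≡ false → closure (pebbled T) k j ≡ true → k ≤ ∣ S ∣

      -- As `u` lies off the cone of (k , j), removing it from both placements changes neither
      -- closure there, while it costs `S` one pebble.
      bottleneck-step : ∀ {k j S T u} → Bottleneck k j → AgreeOff w S T → Avoids k j u → lookup T u ≡ true →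
        closure (pebbled S) k j ≡ false → closure (pebbled T) k j ≡ true → suc k ≤ ∣ S ∣
      bottleneck-step {k} {j} {S} {T} {u} rec agree avoids u∈T open′ closed with lookup S u in u∈S
      ... | true = ≤-trans (s≤s (rec (agreeOff-remove u agree)
              (trans (sym (closure-agreeOff k j (remove-agreeOff S u) avoids)) open′)
              (trans (sym (closure-agreeOff k j (remove-agreeOff T u) avoids)) closed)))
            (≤-reflexive (size-remove S u u∈S))
      ... | false with u ≟ w
      ...   | yes refl = contradiction
              (trans (sym open′) (trans (closure-agreeOff k j agree avoids) closed)) λ ()
      ...   | no u≢w = contradiction (trans (sym u∈S) (trans (at agree u u≢w) u∈T)) λ ()

    -- Some predecessor is still open.  The opposite side of the pyramid avoids the cone below
    -- it, and meets T; that pebble is in S too, as otherwise it would be w and w would not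
    -- matter for the cone.
    bottleneck : ∀ k j → k + j ≤ h → ∀ {S T} → AgreeOff w S T →
      closure (pebbled S) k j ≡ false → closure (pebbled T) k j ≡ true → k ≤ ∣ S ∣
    bottleneck zero    j _ _ _ _ = z≤n
    bottleneck (suc k) j inside {S} {T} agree open′ closed
      with lookup S (vertex (suc k) j) | lookup T (vertex (suc k) j) | at agree (vertex (suc k) j) (bottom inside)
         | closure (pebbled S) k j in openˡ | closure (pebbled S) k (suc j) in openʳ
         | closure (pebbled T) k j in closedˡ | closure (pebbled T) k (suc j) in closedʳ
    -- `S` leaves this vertex open, so has no pebble on it; nor has `T`, because `w` is not above
    -- the bottom row. Hence `T` closes both predecessors and `S` at most one.
    ... | false | false | refl | false | _ | true | true
      with k′ , j′ , sum , u∈T ← closure-right k (suc j) closedʳ =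
        bottleneck-step (bottleneck k j (<⇒≤ inside)) agree avoids u∈T openˡ closedˡ
      where
      avoids : Avoids k j (vertex k′ j′)
      avoids k″ j″ _ r e with refl , refl ← vertex-injective k″ j″ k′ j′
          (≤-trans r (<⇒≤ inside)) (≤-trans (≤-reflexive (trans sum (+-suc k j))) inside) e =
        1+n≰n (≤-trans (≤-reflexive (sym (trans sum (+-suc k j)))) r)
    ... | false | false | refl | true | false | true | true
      with k′ , k′≤k , u∈T ← closure-left k j closedˡ =
        bottleneck-step (bottleneck k (suc j) inside′) agree avoids u∈T openʳ closedʳ
      where
      inside′ : k + suc j ≤ h
      inside′ = ≤-trans (≤-reflexive (+-suc k j)) inside
      avoids : Avoids k (suc j) (vertex k′ j)
      avoids k″ j″ l r e with refl , refl ← vertex-injective k″ j″ k′ j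
          (≤-trans r inside′) (≤-trans (+-monoˡ-≤ j k′≤k) (<⇒≤ inside)) e = 1+n≰n l

    ∂-unblocked-large : ∀ S → ∂ w unblocked S ≡ true → h ≤ ∣ S ∣
    ∂-unblocked-large S e with lookup S w in w∈S
      | closure (pebbled S) h 0 in p | closure (pebbled (S [ w ]≔ false)) h 0 in q
    -- Monotonicity would exclude this case, but the bottleneck is symmetric in the two placements
    -- and bounds it too.
    ... | true | false | true = bottleneck h 0 apex-inside (remove-agreeOff S w) p q
      where apex-inside = ≤-reflexive (+-identityʳ h)
    ... | true | true | false = ≤-trans
        (bottleneck h 0 apex-inside (agreeOff-sym (remove-agreeOff S w)) q p)
        (≤-trans (n≤1+n _) (≤-reflexive (size-remove S w w∈S)))
      where apex-inside = ≤-reflexive (+-identityʳ h)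

  source-bottom : ∀ {i k j} → i ≤ h → suc k + j ≤ h → vertex (suc k) j ≢ vertex 0 i
  source-bottom {i} {k} {j} i≤h inside e = 1+n≢0 (proj₁ (vertex-injective (suc k) j 0 i inside i≤h e))

  -- With both predecessors pebbled the vertex above is closed whether or not it carries a pebble,
  -- and no other vertex notices the change.
  unblocked-move : ∀ {k j} S → suc k + j ≤ h →
    lookup S (vertex k j) ≡ true → lookup S (vertex k (suc j)) ≡ true →
    unblocked S ≡ unblocked (S [ vertex (suc k) j ]≔ false)
  unblocked-move {k} {j} S inside l∈S r∈S = cong not (same h 0 (≤-reflexive (+-identityʳ h)))
    where
    w : Fin size
    w = vertex (suc k) j
    T : Subset size
    T = S [ w ]≔ false
    agree : AgreeOff w S T
    agree = remove-agreeOff S w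
    l∈T : lookup T (vertex k j) ≡ true
    l∈T = trans (sym (at agree _ λ e → 1+n≢n (sym (proj₁ (vertex-injective k j (suc k) j (<⇒≤ inside) inside e))))) l∈S
    r∈T : lookup T (vertex k (suc j)) ≡ true
    r∈T = trans (sym (at agree _ λ e → 1+n≢n (sym (proj₁ (vertex-injective k (suc j) (suc k) j
      (≤-trans (≤-reflexive (+-suc k j)) inside) inside e))))) r∈S
    closed : ∀ U → lookup U (vertex k j) ≡ true → lookup U (vertex k (suc j)) ≡ true →
      closure (pebbled U) (suc k) j ≡ true
    closed U l r = trans
      (cong (pebbled U (suc k) j ∨_) (cong₂ _∧_ (closure-∋ {pebbled U} k j l) (closure-∋ {pebbled U} k (suc j) r)))
      (∨-zeroʳ _)
    same : ∀ k′ j′ → k′ + j′ ≤ h → closure (pebbled S) k′ j′ ≡ closure (pebbled T) k′ j′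
    same zero     j′ p = at agree _ λ e → 0≢1+n (proj₁ (vertex-injective zero j′ (suc k) j p inside e))
    same (suc k′) j′ p with vertex (suc k′) j′ ≟ w
    ... | no  ≢w = cong₂ _∨_ (at agree _ ≢w)
      (cong₂ _∧_ (same k′ j′ (<⇒≤ p)) (same k′ (suc j′) (≤-trans (≤-reflexive (+-suc k′ j′)) p)))
    ... | yes ≡w with refl , refl ← vertex-injective (suc k′) j′ (suc k) j p inside ≡w =
      trans (closed S l∈S r∈S) (sym (closed T l∈T r∈T))

-- Protocols

-- A bit depends on one player's input alone, so it restricts rows or columns and the ranks of the
-- two subtrees add up. The leaf bound w / c is kept as k * c ≤ w to avoid division.
protocol-rank : ∀ {A B O X Y : Set} (f : X → A) (g : Y → B) (M : O → X → Y → Bool) c w →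
  (∀ o → ∃[ k ] (Rank≤ (M o) k × k * c ≤ w)) → (π : Protocol A B O) →
  ∃[ k ] (Rank≤ (λ x y → M (run π (f x) (g y)) x y) k × k * c ≤ 2 ^ depth π * w)
protocol-rank {X = X} {Y} f g M c w leaf = go
  where
  both : ∀ k l a b → k * c ≤ 2 ^ a * w → l * c ≤ 2 ^ b * w → (k + l) * c ≤ 2 ^ suc (a ⊔ b) * w
  both k l a b p q = begin
    (k + l) * c                                ≡⟨ *-distribʳ-+ c k l ⟩
    k * c + l * c                              ≤⟨ +-mono-≤ p q ⟩
    2 ^ a * w + 2 ^ b * w                      ≤⟨ +-mono-≤ (*-monoˡ-≤ w (^-monoʳ-≤ 2 (m≤m⊔n a b)))
                                                           (*-monoˡ-≤ w (^-monoʳ-≤ 2 (m≤n⊔m a b))) ⟩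
    2 ^ (a ⊔ b) * w + 2 ^ (a ⊔ b) * w          ≡⟨ cong (2 ^ (a ⊔ b) * w +_) (+-identityʳ _) ⟨
    2 * (2 ^ (a ⊔ b) * w)                      ≡⟨ *-assoc 2 (2 ^ (a ⊔ b)) w ⟨
    2 ^ suc (a ⊔ b) * w                        ∎
    where open ≤-Reasoning
  go : ∀ π → ∃[ k ] (Rank≤ (λ x y → M (run π (f x) (g y)) x y) k × k * c ≤ 2 ^ depth π * w)
  go (output o) with k , R , bound ← leaf o = k , R , ≤-trans bound (≤-reflexive (sym (*-identityˡ w)))
  go (alice b l r) with k , R , p ← go l | k′ , R′ , p′ ← go r =
    k + k′ ,
    rank-cong (λ x y → if-float (λ o → M o x y) (b (f x))) (rank-ifˡ (b ∘ f) R R′) ,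
    both k k′ (depth l) (depth r) p p′
  go (bob b l r) with k , R , p ← go l | k′ , R′ , p′ ← go r =
    k + k′ ,
    rank-cong (λ x y → if-float (λ o → M o x y) (b (g y))) (rank-ifʳ (b ∘ g) R R′) ,
    both k k′ (depth l) (depth r) p p′

-- Pyramids inside the generation problem

abstract

  pairPoints : ∀ {n} → Fin (n ^ 2) → Fin n × Fin n
  pairPoints {n} = map₂ (proj₁ ∘ remQuot {n} (n ^ 0)) ∘ remQuot {n} (n ^ 1)

  tripletPoints : ∀ {n} → Fin (n ^ 3) → Fin n × Fin n × Fin n
  tripletPoints {n} = map₂ pairPoints ∘ remQuot {n} (n ^ 2)

  tripletPoints-index : ∀ {n} (u v w : Fin n) → tripletPoints (tripletIndex u v w) ≡ (u , v , w)
  tripletPoints-index {n} u v w =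
    trans (cong (map₂ pairPoints) (remQuot-combine {n} {n ^ 2} u (combine v (combine w zero)))) (cong (u ,_) (
    trans (cong (map₂ (proj₁ ∘ remQuot {n} (n ^ 0))) (remQuot-combine {n} {n ^ 1} v (combine w zero)))
    (cong (λ i → v , proj₁ i) (remQuot-combine {n} {n ^ 0} w zero))))

module _ {n : ℕ} {P : Fin n × Fin n × Fin n → Set} (P? : ∀ t → Dec (P t)) where

  abstract

    characteristic : Triplets n
    characteristic = tabulate (does ∘ P? ∘ tripletPoints)

    lookup-characteristic : ∀ t → lookup characteristic t ≡ does (P? (tripletPoints t))
    lookup-characteristic = lookup∘tabulate _

    contains⁺ : ∀ {u v w} → P (u , v , w) → Contains characteristic u v w
    contains⁺ {u} {v} {w} p = trans (lookup-characteristic _)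
      (dec-true (P? _) (subst P (sym (tripletPoints-index u v w)) p))

    contains⁻ : ∀ {u v w} → Contains characteristic u v w → P (u , v , w)
    contains⁻ {u} {v} {w} e = subst P (tripletPoints-index u v w)
      (witness (P? _) (trans (sym (lookup-characteristic _)) e))
      where
      witness : ∀ {t} (d : Dec (P t)) → does d ≡ true → P t
      witness (yes p) _ = p

-- The inputs of Alice and Bob.

module Instances (h ℓ e : ℕ) where

  open Pyramid h

  -- The start `zero`, one point for each vertex and colour, `e` idle points, and the goal in last
  -- place. The idle points pad the instance to any large enough n.
  points : ℕ
  points = suc (size * ℓ + suc e)

  coloured : Fin size → Fin ℓ → Fin points
  coloured v c = suc (combine v c ↑ˡ suc e)

  goal : Fin points
  goal = suc ((size * ℓ) ↑ʳ fromℕ e)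

  coloured-injective : ∀ v c v′ c′ → coloured v c ≡ coloured v′ c′ → v ≡ v′ × c ≡ c′
  coloured-injective v c v′ c′ eq =
    combine-injective v c v′ c′ (↑ˡ-injective (suc e) _ _ (suc-injective eq))

  coloured≢goal : ∀ {v c} → coloured v c ≢ goal
  coloured≢goal {v} {c} eq with () ← trans (sym (splitAt-↑ˡ (size * ℓ) (combine v c) (suc e)))
    (trans (cong (splitAt (size * ℓ)) (suc-injective eq)) (splitAt-↑ʳ (size * ℓ) (suc e) (fromℕ e)))

  point-goal : point goal ≡ points
  point-goal = cong suc (cong suc (trans (toℕ-↑ʳ (size * ℓ) (fromℕ e)) (cong (size * ℓ +_) (toℕ-fromℕ e)))
    ⟨ trans ⟩ sym (+-suc (size * ℓ) e))

  at : Vec (Fin ℓ) size → ℕ → ℕ → Fin points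
  at x k j = coloured (vertex k j) (lookup x (vertex k j))

  Rule : Vec (Fin ℓ) size → Fin points × Fin points × Fin points → Set
  Rule x (p , q , r) =
      (∃[ j ] (p ≡ zero × q ≡ zero × r ≡ at x 0 (toℕ {suc h} j)))
    ⊎ (∃[ k ] ∃[ j ] (suc (toℕ {h} k) + toℕ {h} j ≤ h ×
        p ≡ at x (toℕ k) (toℕ j) × q ≡ at x (toℕ k) (suc (toℕ j)) × r ≡ at x (suc (toℕ k)) (toℕ j)))
    ⊎ (p ≡ at x h 0 × q ≡ at x h 0 × r ≡ goal)

  rule? : ∀ x t → Dec (Rule x t)
  rule? x (p , q , r) =
      any? (λ j → (p ≟ zero) ×-dec (q ≟ zero) ×-dec (r ≟ at x 0 (toℕ j)))
    ⊎-dec any? (λ k → any? λ j → (suc (toℕ k) + toℕ j ≤? h) ×-dec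
        (p ≟ at x (toℕ k) (toℕ j)) ×-dec (q ≟ at x (toℕ k) (suc (toℕ j))) ×-dec (r ≟ at x (suc (toℕ k)) (toℕ j)))
    ⊎-dec ((p ≟ at x h 0) ×-dec (q ≟ at x h 0) ×-dec (r ≟ goal))

  Marked : Vec (Fin ℓ) size → Fin points → Set
  Marked y p = p ≡ zero ⊎ ∃[ v ] (p ≡ coloured v (lookup y v))

  marked? : ∀ y p → Dec (Marked y p)
  marked? y p = (p ≟ zero) ⊎-dec any? λ v → p ≟ coloured v (lookup y v)

  marked-coloured : ∀ y v {c} → Marked y (coloured v c) → c ≡ lookup y v
  marked-coloured y v {c} (inj₂ (u , eq)) with refl , refl ← coloured-injective v c u (lookup y u) eq = refl

  Leaving : Vec (Fin ℓ) size → Fin points × Fin points × Fin points → Set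
  Leaving y (p , q , r) = Marked y p × Marked y q × ¬ Marked y r

  leaving? : ∀ y t → Dec (Leaving y t)
  leaving? y (p , q , r) = marked? y p ×-dec marked? y q ×-dec ¬? (marked? y r)

  generating nongenerating : Vec (Fin ℓ) size → Triplets points
  generating    x = characteristic (rule? x)
  nongenerating y = characteristic (¬? ∘ leaving? y)

  Gen-generating : ∀ x → Gen points (generating x) ≡ true
  Gen-generating x = dec-true (generatesLast? (generating x)) (goal , point-goal ,
    triplet (contains⁺ (rule? x) (inj₂ (inj₂ (refl , refl , refl)))) apex-generated apex-generated)
    where
    pyramid : ∀ k j → k + j ≤ h → Generates (generating x) (at x k j)
    pyramid zero    j p = triplet
      (contains⁺ (rule? x) (inj₁ (fromℕ< (s≤s p) , refl , refl , cong (at x 0) (sym (toℕ-fromℕ< (s≤s p))))))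
      (one refl) (one refl)
    pyramid (suc k) j p = triplet
      (contains⁺ (rule? x) (inj₂ (inj₁ (fromℕ< k<h , fromℕ< j<h , inside ,
        cong₂ (at x) (sym k≡) (sym j≡) , cong₂ (λ k j → at x k (suc j)) (sym k≡) (sym j≡) ,
        cong₂ (λ k j → at x (suc k) j) (sym k≡) (sym j≡)))))
      (pyramid k j (<⇒≤ p)) (pyramid k (suc j) (≤-trans (≤-reflexive (+-suc k j)) p))
      where
      k<h : k < h
      k<h = m+n≤o⇒m≤o (suc k) p
      j<h : j < h
      j<h = ≤-trans (s≤s (m≤n+m j k)) p
      k≡ : toℕ (fromℕ< k<h) ≡ k
      k≡ = toℕ-fromℕ< k<h
      j≡ : toℕ (fromℕ< j<h) ≡ j
      j≡ = toℕ-fromℕ< j<h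
      inside : suc (toℕ (fromℕ< k<h)) + toℕ (fromℕ< j<h) ≤ h
      inside = subst₂ (λ k j → suc k + j ≤ h) (sym k≡) (sym j≡) p
    apex-generated : Generates (generating x) (at x h 0)
    apex-generated = pyramid h 0 (≤-reflexive (+-identityʳ h))

  -- The marked points contain the start, are closed under Bob's triplets, and miss the goal.
  Gen-nongenerating : ∀ y → Gen points (nongenerating y) ≡ false
  Gen-nongenerating y = dec-false (generatesLast? (nongenerating y)) λ (w , last , g) →
    unmarked-goal (subst (Marked y) (toℕ-injective (cong pred (trans last (sym point-goal)))) (marked g))
    where
    marked : ∀ {w} → Generates (nongenerating y) w → Marked y w
    marked (one {zero} _)       = inj₁ refl
    marked (triplet {w = w} c a b) = decidable-stable (marked? y w) λ ¬m →
      contains⁻ (¬? ∘ leaving? y) c (marked a , marked b , ¬m)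
    unmarked-goal : ¬ Marked y goal
    unmarked-goal (inj₂ (v , eq)) = coloured≢goal {v} (sym eq)

  -- The rank of each rectangle.

  SourceColoured : Fin points → Set
  SourceColoured r = ∃[ j ] ∃[ c ] (r ≡ coloured (vertex 0 (toℕ {suc h} j)) c)

  sourceColoured? : ∀ r → Dec (SourceColoured r)
  sourceColoured? r = any? λ j → any? λ c → r ≟ coloured (vertex 0 (toℕ j)) c

  -- The placements whose terms survive may depend on the triplet only, not on x or y: one family
  -- must serve the whole rectangle.
  surviving : Fin points → Subset size → Bool
  surviving r with sourceColoured? r
  ... | yes (j , _) = ∂ (vertex 0 (toℕ j)) unblocked
  ... | no  _       = λ _ → false

  surviving-large : ∀ r S → surviving r S ≡ true → h ≤ ∣ S ∣
  surviving-large r S eq with sourceColoured? r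
  ... | yes (j , _) = ∂-unblocked-large (source-bottom (≤-pred (toℕ<n j))) S eq

  pebbling : Vec (Fin ℓ) size → Vec (Fin ℓ) size → Bool
  pebbling = subsetSum unblocked

  -- Marked premises say that x and y agree on their vertices, and an unmarked coloured conclusion
  -- says that they differ on its vertex; the first restricts the sum, the second makes terms
  -- cancel.
  pebbling-surviving : ∀ x y {p q r} → Rule x (p , q , r) → Leaving y (p , q , r) →
    pebbling x y ≡ subsetSum (surviving r) x y
  pebbling-surviving x y {r = r} rule leaving with sourceColoured? r
  pebbling-surviving x y (inj₁ (i , _ , _ , refl)) (_ , _ , ¬m) | yes (j , c , eq) =
    subsetSum-unequal unblocked x y (vertex 0 (toℕ j)) λ same → ¬m (inj₂ (vertex 0 (toℕ i) ,
      cong (coloured (vertex 0 (toℕ i)))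
        (subst (λ v → lookup x v ≡ lookup y v) (sym (proj₁ (coloured-injective _ _ _ c eq))) same)))
  pebbling-surviving x y (inj₁ (i , _ , _ , refl)) _ | no ¬source = contradiction (i , _ , refl) ¬source
  pebbling-surviving x y (inj₂ (inj₁ (k , j , inside , refl , refl , refl))) _ | yes (i , c , eq) =
    contradiction (proj₁ (coloured-injective _ _ _ _ eq)) (source-bottom (≤-pred (toℕ<n i)) inside)
  -- Only S containing both predecessors count. For these a pebble on `w` does not affect blocking,
  -- so all terms cancel.
  pebbling-surviving x y (inj₂ (inj₁ (k , j , inside , refl , refl , refl))) (ml , mr , ¬m) | no _ = begin
      subsetSum unblocked x y    ≡⟨ subsetSum-equal x y l (marked-coloured y l ml) (λ S e → cong (_∧ unblocked S) (sym e)) ⟩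
      subsetSum φ x y            ≡⟨ subsetSum-equal x y r (marked-coloured y r mr) (λ S e → cong (_∧ φ S) (sym e)) ⟩
      subsetSum ψ x y            ≡⟨ subsetSum-unequal ψ x y w (λ same → ¬m (inj₂ (w , cong (coloured w) same))) ⟩
      subsetSum (∂ w ψ) x y      ≡⟨ subsetSum-cong vanish x y ⟩
      subsetSum (λ _ → false) x y ∎
    where
    open ≡-Reasoning
    l r w : Fin size
    l = vertex (toℕ k) (toℕ j)
    r = vertex (toℕ k) (suc (toℕ j))
    w = vertex (suc (toℕ k)) (toℕ j)
    φ ψ : Subset size → Bool
    φ S = lookup S l ∧ unblocked S
    ψ S = lookup S r ∧ φ S
    l≢w : l ≢ w
    l≢w e = 1+n≢n (sym (proj₁ (vertex-injective (toℕ k) (toℕ j) _ _ (<⇒≤ inside) inside e)))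
    r≢w : r ≢ w
    r≢w e = 1+n≢n (sym (proj₁ (vertex-injective (toℕ k) (suc (toℕ j)) _ _
      (≤-trans (≤-reflexive (+-suc (toℕ k) (toℕ j))) inside) inside e)))
    vanish : ∀ S → ∂ w ψ S ≡ false
    vanish S rewrite lookup∘update′ l≢w S false | lookup∘update′ r≢w S false
      with lookup S l in l∈S | lookup S r in r∈S
    ... | true  | true  rewrite unblocked-move S inside l∈S r∈S =
      trans (cong (lookup S w ∧_) (xor-same (unblocked (S [ w ]≔ false)))) (∧-zeroʳ _)
    ... | true  | false = ∧-zeroʳ _
    ... | false | true  = ∧-zeroʳ _
    ... | false | false = ∧-zeroʳ _
  pebbling-surviving x y (inj₂ (inj₂ (_ , _ , refl))) _ | yes (i , c , eq) = contradiction (sym eq) (coloured≢goal {vertex 0 (toℕ i)} {c})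
  -- The colours agree at the apex, so only S containing the apex count, and none of those is
  -- unblocked.
  pebbling-surviving x y (inj₂ (inj₂ (refl , refl , refl))) (m , _ , _) | no _ =
    subsetSum-equal x y apex (marked-coloured y apex m) unblocked-apex

  -- `pebbling` cut down to the rectangle where `t` is a correct answer: Alice has the triplet and
  -- Bob lacks it.
  separated : Fin (points ^ 3) → Vec (Fin ℓ) size → Vec (Fin ℓ) size → Bool
  separated t x y = lookup (generating x) t ∧ (not (lookup (nongenerating y) t) ∧ pebbling x y)

  private
    guard : ∀ {P Q : Set} (p : Dec P) (q : Dec Q) {a b} → (P → Q → a ≡ b) →
      does p ∧ (not (not (does q)) ∧ a) ≡ does p ∧ (not (not (does q)) ∧ b)
    guard (no  _) _       _ = refl
    guard (yes _) (no  _) _ = refl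
    guard (yes p) (yes q) e = e p q

  -- The membership tests only scale rows and columns, and every surviving S has at least h pebbles;
  -- `weight-large` with q = 2 gives the factor 2 ^ h.
  separated-rank : ∀ t → ∃[ k ] (Rank≤ (separated t) k × k * 2 ^ h ≤ (ℓ + 2) ^ size)
  separated-rank t = weight ℓ (surviving r) ,
    rank-cong restrict (rank-scaleˡ (λ x → lookup (generating x) t)
      (rank-scaleʳ (λ y → not (lookup (nongenerating y) t)) (subsetSum-rank (surviving r)))) ,
    weight-large ℓ 2 h (surviving r) (surviving-large r)
    where
    r : Fin points
    r = proj₂ (proj₂ (tripletPoints t))
    restrict : ∀ x y → separated t x y ≡
      lookup (generating x) t ∧ (not (lookup (nongenerating y) t) ∧ subsetSum (surviving r) x y)
    restrict x y = subst₂
      (λ b c → b ∧ (not c ∧ pebbling x y) ≡ b ∧ (not c ∧ subsetSum (surviving r) x y))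
      (sym (lookup-characteristic (rule? x) t)) (sym (lookup-characteristic (¬? ∘ leaving? y) t))
      (guard (rule? x (tripletPoints t)) (leaving? y (tripletPoints t)) (pebbling-surviving x y))

  -- From protocols to the rank of the identity.

  module _ (m : ℕ) where

    -- The rows after the first are identical for both players and thus admit no valid answer.
    aliceInput bobInput : Vec (Fin ℓ) size → Matrix (suc m) (points ^ 3)
    aliceInput x = generating    x ∷ replicate m (replicate _ false)
    bobInput   y = nongenerating y ∷ replicate m (replicate _ false)

    promise : ∀ x y → map (Gen points) (aliceInput x) ≢ map (Gen points) (bobInput y)
    promise x y eq with () ← trans (sym (Gen-generating x)) (trans (cong head eq) (Gen-nongenerating y))

    private
      <⇒true : ∀ {a b} → a Bool.< b → b ≡ true
      <⇒true Bool.f<t = refl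

      <⇒false : ∀ {a b} → a Bool.< b → a ≡ false
      <⇒false Bool.f<t = refl

    selected : Fin (suc m) × Fin (points ^ 3) → Vec (Fin ℓ) size → Vec (Fin ℓ) size → Bool
    selected (zero  , t) = separated t
    selected (suc _ , _) = λ _ _ → false

    selected-rank : ∀ o → ∃[ k ] (Rank≤ (selected o) k × k * 2 ^ h ≤ (ℓ + 2) ^ size)
    selected-rank (zero  , t) = separated-rank t
    selected-rank (suc _ , _) = 0 , rank-false , z≤n

    selected-valid : ∀ x y o → ValidEntry (Gen points) (aliceInput x) (bobInput y) o →
      pebbling x y ≡ selected o x y
    selected-valid x y (zero , t) (inj₁ (_ , lt)) rewrite <⇒true lt | <⇒false lt = refl
    selected-valid x y (zero , t) (inj₂ (inj₁ (lt , _))) =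
      contradiction (trans (sym (Gen-generating x)) (<⇒false lt)) λ ()
    selected-valid x y (zero , t) (inj₂ (inj₂ (eq , _))) =
      contradiction (trans (sym (Gen-generating x)) (trans eq (Gen-nongenerating y))) λ ()
    selected-valid x y (suc i , t) (inj₁ (lt , _)) =
      contradiction (trans (sym (<⇒true lt)) (<⇒false lt)) λ ()
    selected-valid x y (suc i , t) (inj₂ (inj₁ (lt , _))) =
      contradiction (trans (sym (<⇒true lt)) (<⇒false lt)) λ ()
    selected-valid x y (suc i , t) (inj₂ (inj₂ (_ , neq))) = contradiction refl neq

    -- Adding the blocked placements to `pebbling` gives the sum over all S, the identity matrix on
    -- colourings. Here `k` bounds the rank coming from the protocol and `w` that of the correction.
    rank-bound : ∀ π → Solves (U suc m ⋄mKW (Gen points)) π → ∃[ k ] ∃[ w ]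
      (ℓ ^ size ≤ k + w × w + ℓ ^ size ≤ (ℓ + 1) ^ size × k * 2 ^ h ≤ 2 ^ depth π * (ℓ + 2) ^ size)
    rank-bound π solves with k , R , bound ←
        protocol-rank aliceInput bobInput selected (2 ^ h) ((ℓ + 2) ^ size) selected-rank π =
      k , weight ℓ (not ∘ unblocked) ,
      rank-identity {M = λ i j → identity (colouring i) (colouring j)}
        (rank-reindex colouring colouring (rank-xor
          (rank-cong (λ x y → selected-valid x y (run π (aliceInput x) (bobInput y)) (solves (aliceInput x) (bobInput y) (promise x y))) R)
          (subsetSum-rank (not ∘ unblocked))))
        (λ i → trans (identity≡ (colouring i) (colouring i)) (subsetSum-true-≡ (colouring i)))
        (λ {i} {j} i≢j → trans (identity≡ (colouring i) (colouring j))
          (subsetSum-true-≢ (i≢j ∘ colouring-injective))) ,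
      weight-∌∅ ℓ (not ∘ unblocked) (cong not unblocked-⊥) ,
      bound
      where
      identity : Vec (Fin ℓ) size → Vec (Fin ℓ) size → Bool
      identity x y = pebbling x y xor subsetSum (not ∘ unblocked) x y
      identity≡ : ∀ x y → identity x y ≡ subsetSum (λ _ → true) x y
      identity≡ x y = trans (sym (subsetSum-xor unblocked (not ∘ unblocked) x y))
        (subsetSum-cong (λ S → xor-not (unblocked S)) x y)
        where
        xor-not : ∀ b → b xor not b ≡ true
        xor-not false = refl
        xor-not true  = refl
      colouring : Fin (ℓ ^ size) → Vec (Fin ℓ) size
      colouring i = tabulate (finToFun {ℓ} {size} i)
      colouring-injective : ∀ {i j} → colouring i ≡ colouring j → i ≡ j
      colouring-injective {i} {j} eq = finToFun-injective ℓ size λ v →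
        trans (sym (lookup∘tabulate (finToFun {ℓ} {size} i) v))
          (trans (cong (λ c → lookup c v) eq) (lookup∘tabulate (finToFun {ℓ} {size} j) v))

-- Numerical estimates

-- (1 + 2 / ℓ) ^ i ≤ 1 / (1 − 2 i / ℓ).
bernoulli : ∀ ℓ i t → t + 2 * i ≡ ℓ → (ℓ + 2) ^ i * t ≤ ℓ ^ i * ℓ
bernoulli ℓ zero    t eq = *-monoʳ-≤ 1 (≤-trans (m≤m+n t 0) (≤-reflexive eq))
bernoulli ℓ (suc i) t eq = begin
    (ℓ + 2) * (ℓ + 2) ^ i * t      ≡⟨ reassoc (ℓ + 2) ((ℓ + 2) ^ i) t ⟩
    (ℓ + 2) ^ i * ((ℓ + 2) * t)    ≤⟨ *-monoʳ-≤ ((ℓ + 2) ^ i) step ⟩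
    (ℓ + 2) ^ i * (ℓ * (t + 2))    ≡⟨ reassoc ℓ ((ℓ + 2) ^ i) (t + 2) ⟨
    ℓ * (ℓ + 2) ^ i * (t + 2)      ≡⟨ *-assoc ℓ ((ℓ + 2) ^ i) (t + 2) ⟩
    ℓ * ((ℓ + 2) ^ i * (t + 2))    ≤⟨ *-monoʳ-≤ ℓ (bernoulli ℓ i (t + 2) (trans (shift t i) eq)) ⟩
    ℓ * (ℓ ^ i * ℓ)                ≡⟨ *-assoc ℓ (ℓ ^ i) ℓ ⟨
    ℓ * ℓ ^ i * ℓ                  ∎
  where
  open ≤-Reasoning
  reassoc : ∀ a b c → a * b * c ≡ b * (a * c)
  reassoc = solve-∀
  shift : ∀ t i → t + 2 + 2 * i ≡ t + 2 * suc i
  shift = solve-∀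
  expand : ∀ ℓ t → (ℓ + 2) * t ≡ ℓ * t + 2 * t
  expand = solve-∀
  collect : ∀ ℓ t → ℓ * t + 2 * ℓ ≡ ℓ * (t + 2)
  collect = solve-∀
  step : (ℓ + 2) * t ≤ ℓ * (t + 2)
  step = begin
    (ℓ + 2) * t      ≡⟨ expand ℓ t ⟩
    ℓ * t + 2 * t    ≤⟨ +-monoʳ-≤ (ℓ * t) (*-monoʳ-≤ 2 (≤-trans (m≤m+n t _) (≤-reflexive eq))) ⟩
    ℓ * t + 2 * ℓ    ≡⟨ collect ℓ t ⟩
    ℓ * (t + 2)      ∎

height≤ : ∀ V .{{_ : NonZero V}} → let ℓ = 6 * V in ∀ {h d} →
  ∃[ k ] ∃[ w ] (ℓ ^ V ≤ k + w × w + ℓ ^ V ≤ (ℓ + 1) ^ V × k * 2 ^ h ≤ 2 ^ d * (ℓ + 2) ^ V) →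
  h ≤ 2 + d
height≤ V {h} {d} (k , w , full , missing , bound) =
  ≮⇒≥ λ d<h → <⇒≱ (^-monoʳ-< 2 (s≤s (s≤s z≤n)) d<h) (*-cancelʳ-≤ (2 ^ h) (2 ^ (2 + d)) P powers)
  where
  open ≤-Reasoning
  ℓ P Q : ℕ
  ℓ = 6 * V
  P = ℓ ^ V
  Q = (ℓ + 2) ^ V
  instance
    ℓ≢0 : NonZero ℓ
    ℓ≢0 = m*n≢0 6 V
    P≢0 : NonZero P
    P≢0 = m^n≢0 ℓ V
    2V≢0 : NonZero (2 * V)
    2V≢0 = m*n≢0 2 V
  -- With ℓ = 6 V, (1 + 2 / ℓ) ^ V ≤ 1 / (1 - 2 V / ℓ) = 3 / 2.
  2Q≤3P : 2 * Q ≤ 3 * P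
  2Q≤3P = *-cancelʳ-≤ (2 * Q) (3 * P) (2 * V) (begin
    2 * Q * (2 * V)    ≡⟨ lhs Q V ⟩
    Q * (4 * V)        ≤⟨ bernoulli ℓ V (4 * V) (sum V) ⟩
    P * (6 * V)        ≡⟨ rhs P V ⟩
    3 * P * (2 * V)    ∎)
    where
    sum : ∀ V → 4 * V + 2 * V ≡ 6 * V
    sum = solve-∀
    lhs : ∀ Q V → 2 * Q * (2 * V) ≡ Q * (4 * V)
    lhs = solve-∀
    rhs : ∀ P V → P * (6 * V) ≡ 3 * P * (2 * V)
    rhs = solve-∀
  -- The correction has w ≤ Q - P ≤ P / 2, so at least half of the full rank P is left to `k`.
  P≤2k : P ≤ 2 * k
  P≤2k = +-cancelʳ-≤ (3 * P) P (2 * k) (begin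
    P + 3 * P                ≡⟨ split P ⟩
    2 * (P + P)              ≤⟨ *-monoʳ-≤ 2 (+-monoˡ-≤ P full) ⟩
    2 * (k + w + P)          ≡⟨ cong (2 *_) (+-assoc k w P) ⟩
    2 * (k + (w + P))        ≤⟨ *-monoʳ-≤ 2 (+-monoʳ-≤ k (≤-trans missing (^-monoˡ-≤ V (+-monoʳ-≤ ℓ (s≤s z≤n))))) ⟩
    2 * (k + Q)              ≡⟨ *-distribˡ-+ 2 k Q ⟩
    2 * k + 2 * Q            ≤⟨ +-monoʳ-≤ (2 * k) 2Q≤3P ⟩
    2 * k + 3 * P            ∎)
    where
    split : ∀ P → P + 3 * P ≡ 2 * (P + P)
    split = solve-∀
  powers : 2 ^ h * P ≤ 2 ^ (2 + d) * P
  powers = begin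
    2 ^ h * P                ≤⟨ *-monoʳ-≤ (2 ^ h) P≤2k ⟩
    2 ^ h * (2 * k)          ≡⟨ first (2 ^ h) k ⟩
    2 * (k * 2 ^ h)          ≤⟨ *-monoʳ-≤ 2 bound ⟩
    2 * (2 ^ d * Q)          ≡⟨ second (2 ^ d) Q ⟩
    2 ^ d * (2 * Q)          ≤⟨ *-monoʳ-≤ (2 ^ d) 2Q≤3P ⟩
    2 ^ d * (3 * P)          ≤⟨ *-monoʳ-≤ (2 ^ d) (*-monoˡ-≤ P (n≤1+n 3)) ⟩
    2 ^ d * (4 * P)          ≡⟨ third (2 ^ d) P ⟩
    2 ^ (2 + d) * P          ∎
    where
    first : ∀ a k → a * (2 * k) ≡ 2 * (k * a)
    first = solve-∀
    second : ∀ a Q → 2 * (a * Q) ≡ a * (2 * Q)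
    second = solve-∀
    third : ∀ a P → a * (4 * P) ≡ 2 * (2 * a) * P
    third = solve-∀

sixthRoot : ∀ n → ∃[ r ] (r ^ 6 ≤ n × n < suc r ^ 6)
sixthRoot zero = 0 , z≤n , s≤s z≤n
sixthRoot (suc n) with sixthRoot n
... | r , lower , upper with suc n <? suc r ^ 6
...   | yes p = r , m≤n⇒m≤1+n lower , p
...   | no ¬p = suc r , ≮⇒≥ ¬p , ≤-<-trans upper (^-monoˡ-< 6 (n<1+n (suc r)))

-- In terms of a = r², 2 + 6 a² ≤ 7 a² ≤ a³.
pyramid-fits : ∀ r → 7 ≤ r → 2 + r * r * (6 * (r * r)) ≤ r ^ 6
pyramid-fits r 7≤r = begin
    2 + a * (6 * a)         ≤⟨ +-monoˡ-≤ (a * (6 * a)) (≤-trans (m≤n+m 2 5) (≤-trans 7≤a (m≤n*m a a))) ⟩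
    a * a + a * (6 * a)     ≡⟨ collect a ⟩
    7 * (a * a)             ≤⟨ *-monoˡ-≤ (a * a) 7≤a ⟩
    a * (a * a)             ≡⟨ sixth r ⟩
    r ^ 6                   ∎
  where
  open ≤-Reasoning
  a : ℕ
  a = r * r
  instance
    r≢0 : NonZero r
    r≢0 = >-nonZero (≤-trans (s≤s z≤n) 7≤r)
    a≢0 : NonZero a
    a≢0 = m*n≢0 r r
  7≤a : 7 ≤ a
  7≤a = ≤-trans 7≤r (m≤n*m r r)
  collect : ∀ a → a * a + a * (6 * a) ≡ 7 * (a * a)
  collect = solve-∀
  sixth : ∀ r → r * r * (r * r * (r * r)) ≡ r * (r * (r * (r * (r * (r * 1)))))
  sixth = solve-∀

-- 2 d ≥ 2 r - 6 ≥ r + 1 + 2 m: one copy of r absorbs `m` and the constants, the other remains.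
gap : ∀ {m d r} → 2 * m + 7 ≤ r → r ≤ 3 + d → m ≤ d × suc r ≤ 2 * (d ∸ m)
gap {m} {d} {r} large small = *-cancelˡ-≤ 2 (m+n≤o⇒n≤o (suc r) twice) ,
  ≤-trans (m+n≤o⇒m≤o∸n (suc r) twice) (≤-reflexive (sym (*-distribˡ-∸ 2 d m)))
  where
  open ≤-Reasoning
  rearrange : ∀ r m → suc r + 2 * m + 6 ≡ r + (2 * m + 7)
  rearrange = solve-∀
  double : ∀ d → 3 + d + (3 + d) ≡ 2 * d + 6
  double = solve-∀
  twice : suc r + 2 * m ≤ 2 * d
  twice = +-cancelʳ-≤ 6 _ _ (begin
    suc r + 2 * m + 6    ≡⟨ rearrange r m ⟩
    r + (2 * m + 7)      ≤⟨ +-monoʳ-≤ r large ⟩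
    r + r                ≤⟨ +-mono-≤ small small ⟩
    3 + d + (3 + d)      ≡⟨ double d ⟩
    2 * d + 6            ∎)

-- Assembling the lower bound.

outcome : ∀ {A B O} → Protocol A B O → O
outcome (output o)    = o
outcome (alice _ l _) = outcome l
outcome (bob _ l _)   = outcome l

height-bound : ∀ m h {n d} → 2 + suc h * suc h * (6 * (suc h * suc h)) ≤ n →
  HasCC (U suc m ⋄mKW (Gen n)) d → h ≤ 2 + d
height-bound m h {n} {d} fits cc = bound e (subst (λ n → HasCC (U suc m ⋄mKW (Gen n)) d) n≡ cc)
  where
  V ℓ e : ℕ
  V = Pyramid.size h
  ℓ = 6 * V
  -- The 2 counts the start and the goal; `e` is the surplus.
  fits′ : 2 + V * ℓ ≤ n
  fits′ = subst (λ V → 2 + V * (6 * V) ≤ n) (sym (Pyramid.size-≡ h)) fits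
  e = n ∸ (2 + V * ℓ)
  n≡ : n ≡ suc (V * ℓ + suc e)
  n≡ = trans (sym (m+[n∸m]≡n fits′)) (cong suc (sym (+-suc (V * ℓ) e)))
  instance
    V≢0 : NonZero V
    V≢0 = subst NonZero (sym (Pyramid.size-≡ h)) _
  bound : ∀ e → HasCC (U suc m ⋄mKW (Gen (Instances.points h ℓ e))) d → h ≤ 2 + d
  bound e cc = subst (λ d → h ≤ 2 + d) (proj₂ (proj₂ attained))
    (height≤ V (Instances.rank-bound h ℓ e m (proj₁ attained) (proj₁ (proj₂ attained))))
    where open HasCC cc

theorem6p14 : ∃[ c ] (0 < c ×
    (∀ (m : ℕ) → ∃[ n₀ ] (∀ (n : ℕ) → n₀ ≤ n →
    ∀ (d : ℕ) → HasCC (U m ⋄mKW (Gen n)) d →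
    AtLeastPlusSixthRoot c m n d)))
theorem6p14 = 2 , s≤s z≤n , λ where
    -- Without rows there is no possible output, hence no protocol and no finite complexity.
    zero    → 0 , λ n _ d cc → contradiction (proj₁ (outcome (proj₁ (HasCC.attained cc)))) λ ()
    (suc m) → (2 * suc m + 7) ^ 6 , λ n large d cc → bound m n large d cc
  where
  bound : ∀ m n → (2 * suc m + 7) ^ 6 ≤ n → ∀ d → HasCC (U suc m ⋄mKW (Gen n)) d →
    AtLeastPlusSixthRoot 2 (suc m) n d
  bound m n large d cc with sixthRoot n
  -- A root r below 2 (m + 1) + 7 would give n < (r + 1) ^ 6 ≤ n, by the choice of the threshold.
  ... | r , lower , upper = estimate r lower upper (≮⇒≥ λ small →
          <⇒≱ upper (≤-trans (^-monoˡ-≤ 6 small) large))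
    where
    estimate : ∀ r → r ^ 6 ≤ n → n < suc r ^ 6 → 2 * suc m + 7 ≤ r → AtLeastPlusSixthRoot 2 (suc m) n d
    -- Height r - 1 makes the square have side r. Then r ≤ 3 + d, and n < (r + 1) ^ 6 turns `gap`
    -- into the claim.
    estimate (suc h) lower upper large-root = proj₁ both , ≤-trans (<⇒≤ upper) (^-monoˡ-≤ 6 (proj₂ both))
      where
      fits : 2 + suc h * suc h * (6 * (suc h * suc h)) ≤ n
      fits = ≤-trans (pyramid-fits (suc h) (≤-trans (m≤n+m 7 (2 * suc m)) large-root)) lower
      both : suc m ≤ d × suc (suc h) ≤ 2 * (d ∸ suc m)
      both = gap {suc m} large-root (s≤s (height-bound m h fits cc))
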